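{- For every integer $r$ there exists an integer $k=k(r)$ such that the following holds. If $G$ is a graph whose neighborhood complexity satisfies $\eta_G(m)\le r\cdot m$ for every positive integer $m$, then the vertices of $G$ can be (not necessarily properly) colored with $k$ colors such that for every non-isolated vertex $v$ of $G$ there exists a color which appears on an odd number of vertices of the open neighborhood $N(v)$.
   Context: All graphs are finite and simple. $N(v)$ denotes the open neighborhood of $v$ (not containing $v$). The neighborhood complexity of a graph $G$ is the function $\eta_G(m)=\max_{A}|\{N(v)\cap A : v\in V(G)\}|$, where the maximum is over all $m$-element subsets $A\subseteq V(G)$. -}

module Defs where

open import Data.Bool.Properties using () renaming (_≟_ to _≟ᵇ_)
open import Data.Fin using (Fin)
open import Data.Fin.Properties using (_≟_)
open import Data.Fin.Subset using (Subset; inside; outside; _∩_; ∣_∣)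
open import Data.List using (List; []; _∷_; [_]; map; length; filter; deduplicate; allFin; cartesianProductWith)
open import Data.List.Extrema.Nat using (max)
open import Data.Nat using (ℕ; zero; suc; _%_)
open import Data.Nat.Properties using () renaming (_≟_ to _≟ℕ_)
open import Data.Product using (∃-syntax)
open import Data.Vec using (tabulate; []; _∷_)
open import Data.Vec.Properties using (≡-dec)
open import Level using (0ℓ)
open import Relation.Binary using (Rel; Decidable; Symmetric; Irreflexive)
open import Relation.Binary.PropositionalEquality using (_≡_)
open import Relation.Nullary using (does)

record Graph : Set₁ where
  field
    order  : ℕ
    Adj    : Rel (Fin order) 0ℓ
    adj?   : Decidable Adj
    sym    : Symmetric Adj
    irrefl : Irreflexive _≡_ Adj

  Vertex : Set
  Vertex = Fin order

  N : Vertex → Subset order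
  N v = tabulate (λ u → does (adj? v u))

  NonIsolated : Vertex → Set
  NonIsolated v = ∃[ u ] Adj v u

open Graph public using (Vertex; N; NonIsolated)

allSubsets : (n : ℕ) → List (Subset n)
allSubsets zero    = [ [] ]
allSubsets (suc n) = cartesianProductWith _∷_ (outside ∷ inside ∷ []) (allSubsets n)

subsetsOfSize : (n m : ℕ) → List (Subset n)
subsetsOfSize n m = filter (λ A → ∣ A ∣ ≟ℕ m) (allSubsets n)

-- The set { N(v) ∩ A : v ∈ V(G) }, listed without repetition, so that its
-- length is its cardinality.
traces : (G : Graph) → Subset (Graph.order G) → List (Subset (Graph.order G))
traces G A = deduplicate (≡-dec _≟ᵇ_) (map (λ v → N G v ∩ A) (allFin (Graph.order G)))

-- The maximum over an empty family (when m exceeds the order of G) is 0.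
η : Graph → ℕ → ℕ
η G m = max 0 (map (λ A → length (traces G A)) (subsetsOfSize (Graph.order G) m))

-- Colorings need not be proper.
Coloring : Graph → ℕ → Set
Coloring G k = Vertex G → Fin k

colorClass : (G : Graph) {k : ℕ} → Coloring G k → Fin k → Subset (Graph.order G)
colorClass G c i = tabulate (λ v → does (c v ≟ i))

Odd : ℕ → Set
Odd n = n % 2 ≡ 1

IsOddColoring : (G : Graph) {k : ℕ} → Coloring G k → Set
IsOddColoring G c = ∀ v → NonIsolated G v → ∃[ i ] Odd ∣ N G v ∩ colorClass G c i ∣

{-# OPTIONS --safe #-}
module Submission where

{-
Over the two-element field, a set of rows of rank m has m columns A on which
distinct rows stay distinct; so a family of distinct neighborhoods of rank m has
at most η(m) ≤ r m members.  By Edmonds' matroid partition theorem the nonzero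
neighborhoods split into r linearly independent sets (taking r ≥ 1).  On each
independent set some linear functional X j is constantly 1.  Colour u by the bit
vector (X 1 u , … , X r u): if N v is in the j-th set, then an odd number of
neighbors u of v has X j u = 1, so one of the colours with j-th bit 1 occurs an
odd number of times in N v.

For the partition, let W 0 contain all rows and W (t + 1) those which, for every
j, are in the span of (j-th set) ∩ W t.  If a row e not yet placed is in every
W t, a stable W t violates the rank bound.  Otherwise e ∉ W (t + 1) for some
minimal t, so that either e can be added to some set or it can replace there an
f ∉ W t; the exchange does not enlarge W t, and one continues with f.
-}

open import Defs
import Algebra.Properties.Semiring.Sum
open import Algebra.Bundles using (CommutativeRing)
open import Data.Bool using (Bool; true; false; _∧_; _xor_; _∨_)
open import Data.Bool.Properties using
  ( xor-∧-commutativeRing; xor-identityʳ; xor-same; ∧-zeroʳ; ∧-identityʳ; ∧-comm; ∧-assoc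
  ; ∧-conicalˡ; ∧-distribʳ-xor; ¬-not) renaming (_≟_ to _≟ᵇ_)
open import Data.Fin using (Fin; zero; suc; funToFin; finToFun)
open import Data.Fin.Properties using
  ( _≟_; all?; any?; ¬∀⟶∃¬; suc-injective; injective⇒≤; finToFun-funToFin; 2↔Bool)
open import Data.Fin.Subset using (Subset; Nonempty; inside; outside; _∩_; ∣_∣; ⊥)
open import Data.Fin.Subset.Properties using (nonempty?; ∣⊥∣≡0)
open import Data.Integer using (ℤ; +_; -[1+_]; _*_; _≤_)
open import Data.List as List using (List; []; _∷_; map; length; filter; deduplicate; allFin)
open import Data.List.Extrema.Nat using (xs≤max)
open import Data.List.Membership.Propositional using (_∈_)
open import Data.List.Membership.Propositional.Properties using
  ( ∈-allFin; ∈-map⁺; ∈-map⁻; ∈-filter⁺; ∈-filter⁻; ∈-deduplicate⁺; ∈-deduplicate⁻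
  ; ∈-cartesianProductWith⁺; ∈-lookup)
open import Data.List.Membership.Setoid.Properties using (index-injective)
open import Data.List.Relation.Unary.All as All using (All; []; _∷_)
open import Data.List.Relation.Unary.AllPairs using ([]; _∷_)
open import Data.List.Relation.Unary.Any using (here; there; index)
open import Data.List.Relation.Unary.Any.Properties using (lookup-index)
open import Data.List.Relation.Unary.Unique.DecPropositional.Properties using (deduplicate-!)
open import Data.List.Relation.Unary.Unique.Propositional using (Unique)
open import Data.Nat using (ℕ; zero; suc; _<_; _%_; z≤n; s≤s; _^_; NonZero)
open import Data.Product using (Σ-syntax; ∃-syntax; _×_; _,_; proj₁; proj₂)
open import Data.Sum using (_⊎_; inj₁; inj₂)
open import Data.Unit using (⊤; tt)
open import Data.Vec using (lookup; []; _∷_; _[_]≔_)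
open import Data.Vec.Properties using
  ( lookup∘updateAt; lookup∘updateAt′; lookup∘tabulate; lookup-zipWith; []=⇒lookup; lookup⇒[]=
  ; ≡-dec; tabulate∘lookup; tabulate-cong)
open import Function using (_∘_; Inverse; mk⇔)
open import Function.Definitions using (Injective)
open import Relation.Binary.PropositionalEquality
open import Relation.Nullary using (¬_; Dec; yes; no; does; contradiction)
open import Relation.Nullary.Decidable using (_×-dec_; _→-dec_; dec-true; dec-false; does-⇔)
import Data.Integer as ℤ
import Data.Integer.Properties as ℤ
import Data.Nat as ℕ
import Data.Nat.DivMod as ℕ
import Data.Nat.Properties as ℕ

private
  variable
    m n r : ℕ

module ⊕ = Algebra.Properties.Semiring.Sum (CommutativeRing.semiring xor-∧-commutativeRing)
module ∑ = Algebra.Properties.Semiring.Sum ℕ.+-*-semiring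

-- Linear algebra over the two-element field

xor≡false : ∀ {x y} → x xor y ≡ false → x ≡ y
xor≡false {true}  {true}  _ = refl
xor≡false {false} {false} _ = refl

≡⇒xor : ∀ {x y} → x ≡ y → x xor y ≡ false
≡⇒xor {x} refl = xor-same x

xor-∧-true : ∀ x {y} → y ≡ true → x xor (x ∧ y) ≡ false
xor-∧-true x refl = ≡⇒xor (sym (∧-identityʳ x))

xor-∧-false : ∀ x b {y} → y ≡ false → x xor (b ∧ y) ≡ x
xor-∧-false x b refl = trans (cong (x xor_) (∧-zeroʳ b)) (xor-identityʳ x)

does-≟-refl : (i : Fin n) → does (i ≟ i) ≡ true
does-≟-refl i = dec-true (i ≟ i) refl

⊕-axpy : ∀ (f g : Fin n → Bool) b →
         ⊕.sum (λ i → f i xor (b ∧ g i)) ≡ ⊕.sum f xor (b ∧ ⊕.sum g)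
⊕-axpy f g b = trans (⊕.∑-distrib-+ f (λ i → b ∧ g i))
                     (cong (⊕.sum f xor_) (sym (⊕.*-distribˡ-sum b g)))

⊕-false : ∀ {n} (f : Fin n → Bool) → (∀ i → f i ≡ false) → ⊕.sum f ≡ false
⊕-false {n} f f≡0 = trans (⊕.sum-cong-≗ f≡0) (⊕.sum-replicate-zero n)

⊕-true : ∀ {n} (f : Fin n → Bool) → ⊕.sum f ≡ true → ∃[ i ] f i ≡ true
⊕-true {suc n} f eq with f zero in eq₀
... | true  = zero , eq₀
... | false with i , p ← ⊕-true (f ∘ suc) eq = suc i , p

⊕-select : ∀ (f : Fin n → Bool) k → ⊕.sum (λ i → does (i ≟ k) ∧ f i) ≡ f k
⊕-select {suc n} f zero = trans (cong (f zero xor_) (⊕-false {n} _ (λ _ → refl))) (xor-identityʳ _)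
⊕-select         f (suc k) = ⊕-select (f ∘ suc) k

opaque
  -- The left argument is thought of as a linear functional, the right one as a row on which it is
  -- evaluated.
  ⟨_,_⟩ : (Fin n → Bool) → (Fin n → Bool) → Bool
  ⟨ x , v ⟩ = ⊕.sum (λ u → x u ∧ v u)

  ⟨⟩-sum : ∀ (x v : Fin n → Bool) → ⟨ x , v ⟩ ≡ ⊕.sum (λ u → x u ∧ v u)
  ⟨⟩-sum x v = refl

  ⟨⟩-zeroˡ : ∀ (v : Fin n → Bool) → ⟨ (λ _ → false) , v ⟩ ≡ false
  ⟨⟩-zeroˡ {n} v = ⊕-false {n} _ λ _ → refl

  ⟨⟩-unitˡ : ∀ (v : Fin n → Bool) c → ⟨ (λ u → does (u ≟ c)) , v ⟩ ≡ v c
  ⟨⟩-unitˡ = ⊕-select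

  ⟨⟩-scaleˡ : ∀ (x v : Fin n → Bool) b → ⟨ (λ u → x u ∧ b) , v ⟩ ≡ ⟨ x , v ⟩ ∧ b
  ⟨⟩-scaleˡ x v b = trans (⊕.sum-cong-≗ λ u → exchange (x u) (v u))
                          (sym (⊕.*-distribʳ-sum b (λ u → x u ∧ v u)))
    where
    exchange : ∀ p w → (p ∧ b) ∧ w ≡ (p ∧ w) ∧ b
    exchange p w = trans (∧-assoc p b w) (trans (cong (p ∧_) (∧-comm b w)) (sym (∧-assoc p w b)))

  ⟨⟩-axpyˡ : ∀ (x y v : Fin n → Bool) b →
             ⟨ (λ u → x u xor (b ∧ y u)) , v ⟩ ≡ ⟨ x , v ⟩ xor (b ∧ ⟨ y , v ⟩)
  ⟨⟩-axpyˡ x y v b = trans (⊕.sum-cong-≗ λ u → distrib (x u) (y u) (v u))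
                           (⊕-axpy (λ u → x u ∧ v u) (λ u → y u ∧ v u) b)
    where
    distrib : ∀ p q w → (p xor (b ∧ q)) ∧ w ≡ (p ∧ w) xor (b ∧ (q ∧ w))
    distrib p q w = trans (∧-distribʳ-xor w p (b ∧ q)) (cong ((p ∧ w) xor_) (∧-assoc b q w))

  ⟨⟩-sumˡ : ∀ (x : Fin m → Fin n → Bool) (v : Fin n → Bool) →
            ⟨ (λ u → ⊕.sum (λ s → x s u)) , v ⟩ ≡ ⊕.sum (λ s → ⟨ x s , v ⟩)
  ⟨⟩-sumˡ x v = trans (⊕.sum-cong-≗ λ u → ⊕.*-distribʳ-sum (v u) (λ s → x s u))
                      (⊕.∑-comm (λ u s → x s u ∧ v u))

-- Counting

⟦_⟧ : Bool → ℕ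
⟦ true  ⟧ = 1
⟦ false ⟧ = 0

count : (Fin n → Bool) → ℕ
count b = ∑.sum (λ i → ⟦ b i ⟧)

∑-mono-≤ : ∀ {n} {f g : Fin n → ℕ} → (∀ i → f i ℕ.≤ g i) → ∑.sum f ℕ.≤ ∑.sum g
∑-mono-≤ {zero}  h = z≤n
∑-mono-≤ {suc n} h = ℕ.+-mono-≤ (h zero) (∑-mono-≤ (h ∘ suc))

∑-mono-< : ∀ {n} {f g : Fin n → ℕ} → (∀ i → f i ℕ.≤ g i) → ∀ k → f k < g k → ∑.sum f < ∑.sum g
∑-mono-< h zero    lt = ℕ.+-mono-<-≤ lt (∑-mono-≤ (h ∘ suc))
∑-mono-< h (suc k) lt = ℕ.+-mono-≤-< (h zero) (∑-mono-< (h ∘ suc) k lt)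

-- Applied with both `n` and `k` equal to the number of independent sets, so that this factor can be
-- cancelled: bounds for the single parts then bound their sum.
∑-lower : ∀ {n c k} (f : Fin n → ℕ) → (∀ j → c ℕ.≤ k ℕ.* f j) → n ℕ.* c ℕ.≤ k ℕ.* ∑.sum f
∑-lower {zero}          f h = z≤n
∑-lower {suc n} {c} {k} f h = ℕ.≤-trans (ℕ.+-mono-≤ (h zero) (∑-lower {k = k} (f ∘ suc) (h ∘ suc)))
                                        (ℕ.≤-reflexive (sym (ℕ.*-distribˡ-+ k (f zero) _)))

count-false : ∀ {n} (b : Fin n → Bool) → (∀ i → b i ≡ false) → count b ≡ 0
count-false {n} b b≡0 = trans (∑.sum-cong-≗ (cong ⟦_⟧ ∘ b≡0)) (∑.sum-replicate-zero n)

count-unique : ∀ {n} (b : Fin n → Bool) → (∀ i j → b i ≡ true → b j ≡ true → i ≡ j) → count b ℕ.≤ 1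
count-unique {zero}  b u = z≤n
count-unique {suc n} b u with b zero in eq
... | false = count-unique (b ∘ suc) λ i j p q → suc-injective (u _ _ p q)
... | true  = s≤s (ℕ.≤-reflexive (count-false (b ∘ suc) λ i → ¬-not λ p → contradiction (u zero (suc i) eq p) λ ()))

-- Turns a count into an injection out of a `Fin` type, the form in which the pigeonhole principle
-- is applied.
enumerate : ∀ {n} (b : Fin n → Bool) →
            Σ[ f ∈ (Fin (count b) → Fin n) ] Injective _≡_ _≡_ f × (∀ k → b (f k) ≡ true)
enumerate {zero}  b = (λ ()) , (λ {}) , λ ()
enumerate {suc n} b with b zero in eq | enumerate (b ∘ suc)
... | false | f , inj , f∈b = suc ∘ f , inj ∘ suc-injective , f∈b
... | true  | f , inj , f∈b = g , g-inj , g∈b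
  where
  g : Fin (suc (count (b ∘ suc))) → Fin (suc n)
  g zero    = zero
  g (suc k) = suc (f k)
  g-inj : Injective _≡_ _≡_ g
  g-inj {zero}  {zero}  _ = refl
  g-inj {suc k} {suc l} p = cong suc (inj (suc-injective p))
  g∈b : ∀ k → b (g k) ≡ true
  g∈b zero    = eq
  g∈b (suc k) = f∈b k

does-true : ∀ {ℓ} {P : Set ℓ} (P? : Dec P) → does P? ≡ true → P
does-true (yes p) _ = p

does-mono : ∀ {P Q : Set} (P? : Dec P) (Q? : Dec Q) → (P → Q) → ⟦ does P? ⟧ ℕ.≤ ⟦ does Q? ⟧
does-mono (no _)  _       f = z≤n
does-mono (yes p) (yes _) f = ℕ.≤-refl
does-mono (yes p) (no ¬q) f = contradiction (f p) ¬q

-- Every unstable step of the descending chain loses an element, so the size of the zeroth set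
-- bounds the number of steps; the fuel is one more than that size.
stabilises : ∀ {N} (W : ℕ → Fin N → Set) (W? : ∀ t s → Dec (W t s)) →
             (∀ t s → W (suc t) s → W t s) → ∃[ t ] (∀ s → W t s → W (suc t) s)
stabilises {N} W W? antitone = go (suc (count (does ∘ W? 0))) 0 ℕ.≤-refl
  where
  go : ∀ fuel t → count (does ∘ W? t) < fuel → ∃[ t ] (∀ s → W t s → W (suc t) s)
  go (suc fuel) t (s≤s le) with all? (λ s → W? t s →-dec W? (suc t) s)
  ... | yes stable = t , stable
  ... | no unstable with ¬∀⟶∃¬ N _ (λ s → W? t s →-dec W? (suc t) s) unstable
  ...   | s , ¬imp = go fuel (suc t) (ℕ.<-≤-trans (∑-mono-< (λ i → does-mono (W? (suc t) i) (W? t i) (antitone t i)) s lt) le)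
    where
    lt : ⟦ does (W? (suc t) s) ⟧ < ⟦ does (W? t s) ⟧
    lt with W? t s | W? (suc t) s
    ... | yes _ | no _  = ℕ.≤-refl
    ... | yes _ | yes q = contradiction (λ _ → q) ¬imp
    ... | no ¬p | _     = contradiction (λ p → contradiction p ¬p) ¬imp

-- Column bases by elimination

∣[]≔inside∣≤ : ∀ {n} (p : Subset n) i → ∣ p [ i ]≔ inside ∣ ℕ.≤ suc ∣ p ∣
∣[]≔inside∣≤ (true  ∷ p) zero    = ℕ.n≤1+n _
∣[]≔inside∣≤ (false ∷ p) zero    = ℕ.≤-refl
∣[]≔inside∣≤ (true  ∷ p) (suc i) = s≤s (∣[]≔inside∣≤ p i)
∣[]≔inside∣≤ (false ∷ p) (suc i) = ∣[]≔inside∣≤ p i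

∈⇒0<∣∣ : ∀ {n} (p : Subset n) i → lookup p i ≡ inside → 0 < ∣ p ∣
∈⇒0<∣∣ (true  ∷ p) _       _  = s≤s z≤n
∈⇒0<∣∣ (false ∷ p) (suc i) eq = ∈⇒0<∣∣ p i eq

-- Gaussian elimination: after pivoting on an entry of row 0, a combination
-- that vanishes in the pivot column is a combination of the reduced rows.
columnBasis : ∀ {N n} (v : Fin N → Fin n → Bool) (b : Fin N → Bool) →
  (∀ s → b s ≡ false → ∀ c → v s c ≡ false) →
  Σ[ A ∈ Subset n ] ∣ A ∣ ℕ.≤ count b ×
    (∀ (a : Fin N → Bool) → (∀ c → lookup A c ≡ inside → ⊕.sum (λ s → a s ∧ v s c) ≡ false) →
           ∀ c → ⊕.sum (λ s → a s ∧ v s c) ≡ false)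
columnBasis {zero}  {n} v b v⊆b = ⊥ , ℕ.≤-reflexive (∣⊥∣≡0 n) , λ _ _ _ → refl
columnBasis {suc N} v b v⊆b with any? (λ c → v zero c ≟ᵇ true)
... | no v₀≡0 with A , ∣A∣≤ , basis ← columnBasis (v ∘ suc) (b ∘ suc) (v⊆b ∘ suc) =
    A , ℕ.≤-trans ∣A∣≤ (ℕ.m≤n+m _ ⟦ b zero ⟧) , λ a vanish c →
    trans (drop a c) (basis (a ∘ suc) (λ c′ c′∈A → trans (sym (drop a c′)) (vanish c′ c′∈A)) c)
  where
  drop : ∀ (a : Fin (suc N) → Bool) c → ⊕.sum (λ s → a s ∧ v s c) ≡ ⊕.sum (λ s → a (suc s) ∧ v (suc s) c)
  drop a c rewrite ¬-not (λ p → v₀≡0 (c , p)) | ∧-zeroʳ (a zero) = refl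
... | yes (p , v₀p) with columnBasis (λ s c → v (suc s) c xor (v (suc s) p ∧ v zero c)) (b ∘ suc) reduced⊆b
  where
  -- A zero row has a zero in the pivot column too, hence is unchanged by the reduction; so `b`
  -- still bounds the support of the reduced rows.
  reduced⊆b : ∀ s → b (suc s) ≡ false → ∀ c → v (suc s) c xor (v (suc s) p ∧ v zero c) ≡ false
  reduced⊆b s eq c rewrite v⊆b (suc s) eq c | v⊆b (suc s) eq p = refl
... | A , ∣A∣≤ , basis = A [ p ]≔ inside , bound , λ a vanish c →
      trans (sym (reduce a (vanish p (lookup∘updateAt p A)) c))
            (basis (a ∘ suc) (λ c′ c′∈A → trans (reduce a (vanish p (lookup∘updateAt p A)) c′)
                                                (vanish c′ (enlarge c′ c′∈A))) c)
  where
  b₀ : b zero ≡ true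
  b₀ with b zero in eq
  ... | true  = refl
  ... | false = contradiction (trans (sym v₀p) (v⊆b zero eq p)) λ ()

  bound : ∣ A [ p ]≔ inside ∣ ℕ.≤ count b
  bound rewrite b₀ = ℕ.≤-trans (∣[]≔inside∣≤ A p) (s≤s ∣A∣≤)

  enlarge : ∀ c → lookup A c ≡ inside → lookup (A [ p ]≔ inside) c ≡ inside
  enlarge c c∈A with c ≟ p
  ... | yes refl = lookup∘updateAt p A
  ... | no c≢p   = trans (lookup∘updateAt′ c p c≢p A) c∈A

  reduce : ∀ (a : Fin (suc N) → Bool) → ⊕.sum (λ s → a s ∧ v s p) ≡ false → ∀ c →
           ⊕.sum (λ s → a (suc s) ∧ (v (suc s) c xor (v (suc s) p ∧ v zero c))) ≡ ⊕.sum (λ s → a s ∧ v s c)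
  reduce a vanish c = begin
    ⊕.sum (λ s → a (suc s) ∧ (v (suc s) c xor (v (suc s) p ∧ v zero c)))
      ≡⟨ ⊕.sum-cong-≗ (λ s → rearrange (a (suc s)) (v (suc s) c) (v (suc s) p) (v zero c)) ⟩
    ⊕.sum (λ s → (a (suc s) ∧ v (suc s) c) xor (v zero c ∧ (a (suc s) ∧ v (suc s) p)))
      ≡⟨ ⊕-axpy {N} _ _ (v zero c) ⟩
    S xor (v zero c ∧ ⊕.sum (λ s → a (suc s) ∧ v (suc s) p))
      -- Row zero has a 1 in column `p`, so vanishing there forces `a zero` to be the sum of the
      -- other terms.
      ≡⟨ cong (λ z → S xor (v zero c ∧ z)) (trans (sym (xor≡false vanish)) (trans (cong (a zero ∧_) v₀p) (∧-identityʳ _))) ⟩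
    S xor (v zero c ∧ a zero)
      ≡⟨ swap S (v zero c) (a zero) ⟩
    (a zero ∧ v zero c) xor S ∎
    where
    open ≡-Reasoning
    S = ⊕.sum (λ s → a (suc s) ∧ v (suc s) c)
    rearrange : ∀ w x y z → w ∧ (x xor (y ∧ z)) ≡ (w ∧ x) xor (z ∧ (w ∧ y))
    rearrange false x y true  = refl
    rearrange false x y false = refl
    rearrange true  x y z     = cong (x xor_) (∧-comm y z)
    swap : ∀ x y z → x xor (y ∧ z) ≡ (z ∧ y) xor x
    swap x y z = trans (CommutativeRing.+-comm xor-∧-commutativeRing x (y ∧ z)) (cong (_xor x) (∧-comm y z))

-- Partition of the rows of a matrix into independent sets

module Matrix {N n : ℕ} (M : Fin N → Fin n → Bool) (r : ℕ) where

  -- r disjoint independent sets of rows, given by dual bases: row s lies in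
  -- the j-th set iff coef j s s is true, and coef j g s is then the coefficient
  -- of row s when row g is expanded in the j-th set (if it lies in the span).
  record Packing : Set where
    field
      dual : Fin r → Fin N → Fin n → Bool

    coef : Fin r → Fin N → Fin N → Bool
    coef j g s = ⟨ dual j s , M g ⟩

    Member : Fin r → Fin N → Set
    Member j s = coef j s s ≡ true

    field
      support  : ∀ j s → coef j s s ≡ false → ∀ g → coef j g s ≡ false
      diagonal : ∀ j {s s′} → Member j s′ → s′ ≢ s → coef j s′ s ≡ false
      disjoint : ∀ {i j} s → Member i s → Member j s → i ≡ j

    member : ∀ {j g s} → coef j g s ≡ true → Member j s
    member {j} {g} {s} p with coef j s s in eq
    ... | true  = refl
    ... | false = contradiction (trans (sym p) (support j s eq g)) λ ()

    expansion : Fin r → Fin N → Fin n → Bool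
    expansion j g c = ⊕.sum (λ s → coef j g s ∧ M s c)

    Covered Uncovered : Fin N → Set
    Covered s = ∃[ j ] Member j s
    Uncovered s = ∀ j → coef j s s ≡ false

    -- Membership in W (suc t) says that for every j the row lies in the span of
    -- those members of the j-th set which belong to W t.
    W : ℕ → Fin N → Set
    W zero    g = ⊤
    W (suc t) g = ∀ j → (∀ c → M g c ≡ expansion j g c) × (∀ s → coef j g s ≡ true → W t s)

    W? : ∀ t g → Dec (W t g)
    W? zero    g = yes tt
    W? (suc t) g = all? λ j → all? (λ c → M g c ≟ᵇ expansion j g c)
                        ×-dec all? (λ s → (coef j g s ≟ᵇ true) →-dec W? t s)

    W-antitone : ∀ t g → W (suc t) g → W t g
    W-antitone zero    g w   = tt
    W-antitone (suc t) g w j = proj₁ (w j) , λ s p → W-antitone t s (proj₂ (w j) s p)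

  open Packing

  empty : Packing
  empty .dual j s u = false
  empty .support j s _ g = ⟨⟩-zeroˡ (M g)
  empty .diagonal j {s′ = s′} _ _ = ⟨⟩-zeroˡ (M s′)
  empty .disjoint s p _ = contradiction (trans (sym p) (⟨⟩-zeroˡ (M s))) λ ()

  -- Enter row e into the j-th set by means of a functional y with y e = 1; the
  -- only member on which y may be nonzero is the one whose dual is y: it leaves.
  module Pivot (C : Packing) (j : Fin r) (e : Fin N) (y : Fin n → Bool)
    (e∉ : Uncovered C e) (ye : ⟨ y , M e ⟩ ≡ true)
    (leaving : ∀ s → Member C j s →
               ⟨ y , M s ⟩ ≡ false ⊎ (coef C j e s ≡ true × (∀ g → ⟨ y , M g ⟩ ≡ coef C j g s)))
    where

    opaque
      -- A rank-one update: in the j-th set, the functional x of row `s` becomes x + (x(e) +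
      -- [s = e]) y. As `y` is 1 at `e`, the new functional vanishes at `e` when `s ≠ e`. For
      -- `s = e` it agrees with `y` on all rows. For a leaving row, x agrees with `y` and x(e) = 1,
      -- so it becomes zero on all rows.
      dual′ : Fin r → Fin N → Fin n → Bool
      dual′ i s u = dual C i s u xor ((does (i ≟ j) ∧ (coef C j e s xor does (s ≟ e))) ∧ y u)

      coef′-at : ∀ g s → ⟨ dual′ j s , M g ⟩ ≡ coef C j g s xor ((coef C j e s xor does (s ≟ e)) ∧ ⟨ y , M g ⟩)
      coef′-at g s = trans (⟨⟩-axpyˡ (dual C j s) y (M g) _)
                           (cong (λ d → coef C j g s xor ((d ∧ _) ∧ ⟨ y , M g ⟩)) (does-≟-refl j))

      coef′-off : ∀ {i} → i ≢ j → ∀ g s → ⟨ dual′ i s , M g ⟩ ≡ coef C i g s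
      coef′-off {i} i≢j g s =
        trans (⟨⟩-axpyˡ (dual C i s) y (M g) _)
              (trans (cong (λ d → coef C i g s xor ((d ∧ _) ∧ ⟨ y , M g ⟩)) (dec-false (i ≟ j) i≢j)) (xor-identityʳ _))

    coef′ : Fin r → Fin N → Fin N → Bool
    coef′ i g s = ⟨ dual′ i s , M g ⟩

    coef′-new : ∀ g → coef′ j g e ≡ ⟨ y , M g ⟩
    coef′-new g rewrite coef′-at g e | support C j e (e∉ j) g | e∉ j | does-≟-refl e = refl

    coef′-old : ∀ g {s} → s ≢ e → coef′ j g s ≡ coef C j g s xor (coef C j e s ∧ ⟨ y , M g ⟩)
    coef′-old g {s} s≢e rewrite coef′-at g s | dec-false (s ≟ e) s≢e | xor-identityʳ (coef C j e s) = refl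

    stays : ∀ {s} → s ≢ e → coef′ j s s ≡ true → Member C j s × ⟨ y , M s ⟩ ≡ false
    stays {s} s≢e p with coef C j s s in eq
    ... | false = contradiction (trans (sym p) absent) λ ()
      where
      absent : coef′ j s s ≡ false
      absent rewrite coef′-old s s≢e | eq | support C j s eq e = refl
    ... | true with leaving s eq
    ...   | inj₁ ys = refl , ys
    ...   | inj₂ (es , y≡) = contradiction (trans (sym p) left) λ ()
      where
      left : coef′ j s s ≡ false
      left rewrite coef′-old s s≢e | eq | es | y≡ s | eq = refl

    support′ : ∀ i s → coef′ i s s ≡ false → ∀ g → coef′ i g s ≡ false
    support′ i s p g with i ≟ j
    ... | no i≢j = trans (coef′-off i≢j g s) (support C i s (trans (sym (coef′-off i≢j s s)) p) g)
    ... | yes refl with s ≟ e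
    ...   | yes refl = contradiction (trans (sym p) (trans (coef′-new e) ye)) λ ()
    ...   | no s≢e with coef C j s s in eq
    ...     | false rewrite coef′-old g s≢e | support C j s eq g | support C j s eq e = refl
    ...     | true with leaving s eq
    ...       | inj₁ ys = contradiction (trans (sym p) kept) λ ()
      where
      kept : coef′ j s s ≡ true
      kept = trans (coef′-old s s≢e) (trans (xor-∧-false _ (coef C j e s) ys) eq)
    ...       | inj₂ (es , y≡) rewrite coef′-old g s≢e | es | y≡ g = xor-same (coef C j g s)

    diagonal′ : ∀ i {s s′} → coef′ i s′ s′ ≡ true → s′ ≢ s → coef′ i s′ s ≡ false
    diagonal′ i {s} {s′} p s′≢s with i ≟ j
    ... | no i≢j = trans (coef′-off i≢j s′ s) (diagonal C i (trans (sym (coef′-off i≢j s′ s′)) p) s′≢s)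
    ... | yes refl with s′ ≟ e | s ≟ e
    ...   | yes refl | yes s≡e = contradiction (sym s≡e) s′≢s
    ...   | yes refl | no s≢e = trans (coef′-old e s≢e) (xor-∧-true (coef C j e s) ye)
    ...   | no s′≢e | yes refl = trans (coef′-new s′) (proj₂ (stays s′≢e p))
    ...   | no s′≢e | no s≢e with m , ys ← stays s′≢e p =
      trans (coef′-old s′ s≢e) (trans (xor-∧-false _ (coef C j e s) ys) (diagonal C j m s′≢s))

    member′ : ∀ {i s} → s ≢ e → coef′ i s s ≡ true → Member C i s
    member′ {i} {s} s≢e p with i ≟ j
    ... | yes refl = proj₁ (stays s≢e p)
    ... | no i≢j   = trans (sym (coef′-off i≢j s s)) p

    entered : ∀ {i} → coef′ i e e ≡ true → i ≡ j
    entered {i} p with i ≟ j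
    ... | yes i≡j = i≡j
    ... | no i≢j  = contradiction (trans (sym p) (trans (coef′-off i≢j e e) (e∉ i))) λ ()

    disjoint′ : ∀ {i k} s → coef′ i s s ≡ true → coef′ k s s ≡ true → i ≡ k
    disjoint′ s p q with s ≟ e
    ... | yes refl = trans (entered p) (sym (entered q))
    ... | no s≢e   = disjoint C s (member′ s≢e p) (member′ s≢e q)

    result : Packing
    result = record { dual = dual′ ; support = support′ ; diagonal = λ i → diagonal′ i ; disjoint = disjoint′ }

    covers-new : Covered result e
    covers-new = j , trans (coef′-new e) ye

    covers-old : ∀ {s} → Covered C s → (Member C j s → ⟨ y , M s ⟩ ≡ false) → Covered result s
    covers-old {s} (i , m) ys with i ≟ j
    ... | no i≢j   = i , trans (coef′-off i≢j s s) m
    ... | yes refl = j , kept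
      where
      s≢e : s ≢ e
      s≢e refl = contradiction (trans (sym m) (e∉ j)) λ ()
      kept : coef′ j s s ≡ true
      kept = trans (coef′-old s s≢e) (trans (xor-∧-false _ (coef C j e s) (ys m)) m)

  -- Augmentation and exchange

  δ-member : ∀ C j {s} → Member C j s → ∀ s′ → coef C j s s′ ≡ does (s′ ≟ s)
  δ-member C j {s} m s′ with s′ ≟ s
  ... | yes refl = m
  ... | no s′≢s  = diagonal C j m (s′≢s ∘ sym)

  expansion-member : ∀ C j {s} → Member C j s → ∀ c → expansion C j s c ≡ M s c
  expansion-member C j {s} m c =
    trans (⊕.sum-cong-≗ λ s′ → cong (_∧ M s′ c) (δ-member C j m s′)) (⊕-select (λ s′ → M s′ c) s)

  -- Only coverage is retained, since a row may move from one independent set to another.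
  _Extends_by_ : Packing → Packing → Fin N → Set
  C′ Extends C by e = (∀ s → Covered C s → Covered C′ s) × Covered C′ e

  -- The functional g ↦ M g c xor expansion j g c vanishes on the j-th set.
  augment : ∀ C e → Uncovered C e → ∀ j c → M e c ≢ expansion C j e c → ∃[ C′ ] C′ Extends C by e
  augment C e e∉ j c e∉span = result , (λ s cov → covers-old cov (y-member s)) , covers-new
    where
    y : Fin n → Bool
    y u = does (u ≟ c) xor (true ∧ ⊕.sum (λ s → dual C j s u ∧ M s c))
    y-value : ∀ g → ⟨ y , M g ⟩ ≡ M g c xor expansion C j g c
    y-value g = trans (⟨⟩-axpyˡ (λ u → does (u ≟ c)) _ (M g) true)
      (cong₂ _xor_ (⟨⟩-unitˡ (M g) c)
        (trans (⟨⟩-sumˡ (λ s u → dual C j s u ∧ M s c) (M g))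
               (⊕.sum-cong-≗ λ s → ⟨⟩-scaleˡ (dual C j s) (M g) (M s c))))
    y-member : ∀ s → Member C j s → ⟨ y , M s ⟩ ≡ false
    y-member s m = trans (y-value s) (≡⇒xor (sym (expansion-member C j m c)))
    open Pivot C j e y e∉ (trans (y-value e) (¬-not (e∉span ∘ xor≡false))) (λ s m → inj₁ (y-member s m))

  -- As `f` occurs in the expansion of `e`, the functional dual to `f` is 1 at `e` and can serve as
  -- `y`; among the members it is nonzero only at `f`.
  module Exchange (C : Packing) (e : Fin N) (e∉ : Uncovered C e) (j : Fin r) (f : Fin N)
                  (ef : coef C j e f ≡ true) where

    f∈ : Member C j f
    f∈ = member C ef

    leaving : ∀ s → Member C j s →
              coef C j s f ≡ false ⊎ (coef C j e s ≡ true × (∀ g → coef C j g f ≡ coef C j g s))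
    leaving s s∈ with s ≟ f
    ... | yes refl = inj₂ (ef , λ g → refl)
    ... | no s≢f   = inj₁ (diagonal C j s∈ s≢f)

    open Pivot C j e (dual C j f) e∉ ef leaving public

    f∉ : Uncovered result f
    f∉ i with i ≟ j
    ... | yes refl = trans (coef′-old f f≢e) (cong₂ (λ a b → a xor (b ∧ a)) f∈ ef)
      where
      f≢e : f ≢ e
      f≢e refl = contradiction (trans (sym f∈) (e∉ j)) λ ()
    ... | no i≢j = trans (coef′-off i≢j f f) (¬-not λ p → i≢j (disjoint C f p f∈))

    others-covered : ∀ {s} → s ≢ f → Covered C s → Covered result s
    others-covered s≢f cov = covers-old cov λ m → diagonal C j m s≢f

    module _ (span : ∀ c → M e c ≡ expansion C j e c) where

      -- The coordinates of `g` change by a multiple of the circuit formed by `e` and the terms of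
      -- its expansion, and the rows of that circuit sum to zero.
      expansion′ : ∀ g c → expansion result j g c ≡ expansion C j g c
      expansion′ g c = begin
        ⊕.sum (λ s → coef′ j g s ∧ M s c)
          ≡⟨ ⊕.sum-cong-≗ (λ s → trans (cong (_∧ M s c) (coef′-at g s))
                                       (distrib (coef C j g s) (coef C j e s) (does (s ≟ e)) (M s c))) ⟩
        ⊕.sum (λ s → (coef C j g s ∧ M s c) xor (coef C j g f ∧ ((coef C j e s ∧ M s c) xor (does (s ≟ e) ∧ M s c))))
          ≡⟨ ⊕-axpy (λ s → coef C j g s ∧ M s c) (λ s → (coef C j e s ∧ M s c) xor (does (s ≟ e) ∧ M s c)) (coef C j g f) ⟩
        expansion C j g c xor (coef C j g f ∧ ⊕.sum (λ s → (coef C j e s ∧ M s c) xor (does (s ≟ e) ∧ M s c)))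
          ≡⟨ xor-∧-false _ (coef C j g f) circuit ⟩
        expansion C j g c ∎
        where
        open ≡-Reasoning
        distrib : ∀ a b d m → (a xor ((b xor d) ∧ coef C j g f)) ∧ m ≡ (a ∧ m) xor (coef C j g f ∧ ((b ∧ m) xor (d ∧ m)))
        distrib a b d m = trans (∧-distribʳ-xor m a _) (cong ((a ∧ m) xor_)
          (trans (cong (_∧ m) (∧-comm (b xor d) (coef C j g f)))
                 (trans (∧-assoc (coef C j g f) (b xor d) m) (cong (coef C j g f ∧_) (∧-distribʳ-xor m b d)))))
        circuit : ⊕.sum (λ s → (coef C j e s ∧ M s c) xor (does (s ≟ e) ∧ M s c)) ≡ false
        circuit = trans (⊕.∑-distrib-+ (λ s → coef C j e s ∧ M s c) (λ s → does (s ≟ e) ∧ M s c))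
                        (≡⇒xor (trans (sym (span c)) (sym (⊕-select (λ s → M s c) e))))

      -- The critical case is a row `s` in the old expansion of `g` in the j-th set. If `s` also
      -- occurs in the expansion of `e`, it is in the lower level because `e` is in the level above.
      -- Otherwise its coefficient survives the exchange and induction applies.
      W-shrinks : ∀ t g → W C t e → W result t g → W C t g
      W-shrinks zero    g we wg = tt
      W-shrinks (suc t) g we wg i with i ≟ j
      ... | no i≢j = (λ c → trans (proj₁ (wg i) c) (⊕.sum-cong-≗ λ s → cong (_∧ M s c) (coef′-off i≢j g s)))
                   , λ s p → W-shrinks t s (W-antitone C t e we) (proj₂ (wg i) s (trans (coef′-off i≢j g s) p))
      ... | yes refl = (λ c → trans (proj₁ (wg j) c) (expansion′ g c)) , inside-W
        where
        inside-W : ∀ s → coef C j g s ≡ true → W C t s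
        inside-W s p with coef C j e s in es
        ... | true  = proj₂ (we j) s es
        ... | false = W-shrinks t s (W-antitone C t e we) (proj₂ (wg j) s still)
          where
          s≢e : s ≢ e
          s≢e refl = contradiction (trans (sym p) (support C j e (e∉ j) g)) λ ()
          still : coef′ j g s ≡ true
          still = trans (coef′-old g s≢e) (cong₂ (λ a b → a xor (b ∧ coef C j g f)) p es)

  -- The level `t` is the recursion measure: a displaced row misses an earlier level than `e` did,
  -- and level zero misses no row.
  extend : ∀ t C e → Uncovered C e → ¬ W C t e → ∃[ C′ ] C′ Extends C by e
  extend zero    C e e∉ ¬w = contradiction tt ¬w
  extend (suc t) C e e∉ ¬w with W? C t e
  ... | no ¬w′ = extend t C e e∉ ¬w′
  ... | yes w with ¬∀⟶∃¬ r _ (λ j → all? (λ c → M e c ≟ᵇ expansion C j e c)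
                                    ×-dec all? (λ s → (coef C j e s ≟ᵇ true) →-dec W? C t s)) ¬w
  ...   | j , ¬wj with all? (λ c → M e c ≟ᵇ expansion C j e c)
  ...     | no ¬span with c , e∉span ← ¬∀⟶∃¬ n _ (λ c → M e c ≟ᵇ expansion C j e c) ¬span = augment C e e∉ j c e∉span
  ...     | yes span with ¬∀⟶∃¬ N _ (λ s → (coef C j e s ≟ᵇ true) →-dec W? C t s) (λ all → ¬wj (span , all))
  ...       | f , ¬imp with coef C j e f ≟ᵇ true
  ...         | no ¬ef = contradiction (λ ef → contradiction ef ¬ef) ¬imp
  -- `f` is outside `W C t`, and `W-shrinks` keeps it outside after the exchange.
  ...         | yes ef with extend t result f f∉ (λ wf → ¬imp λ _ → W-shrinks span t f w wf)
    where open Exchange C e e∉ j f ef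
  ...           | C′ , keeps , f∈′ = C′ , covers , keeps e covers-new
    where
    open Exchange C e e∉ j f ef
    covers : ∀ s → Covered C s → Covered C′ s
    -- Of the rows covered before, only `f` loses its place in the exchange; the recursive call
    -- finds it a new one.
    covers s cov with s ≟ f
    ... | yes refl = f∈′
    ... | no s≢f   = keeps s (others-covered s≢f cov)

  -- `sparse` is the matrix form of the complexity bound: rows that are pairwise distinguished by
  -- the columns in `A` have as many traces on `A` as there are rows.
  module _ .⦃ r≢0 : NonZero r ⦄
           (distinct : ∀ s s′ → (∀ c → M s c ≡ M s′ c) → s ≡ s′)
           (nonzero : ∀ s → ∃[ c ] M s c ≡ true)
           (sparse : ∀ (R : Fin N → Bool) (A : Subset n) → 0 < ∣ A ∣ →
                     (∀ s s′ → R s ≡ true → R s′ ≡ true →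
                        (∀ c → lookup A c ≡ inside → M s c ≡ M s′ c) → s ≡ s′) →
                     count R ℕ.≤ r ℕ.* ∣ A ∣)
    where

    -- A stable level of W spans, together with e, no more than each of its r
    -- parts does, so it has at least r * rank + 1 elements.
    not-stable : ∀ C e → Uncovered C e → ∀ t → (∀ s → W C t s → W C (suc t) s) → ¬ W C t e
    not-stable C e e∉ t stable we = ℕ.<-irrefl refl (ℕ.<-≤-trans parts<whole whole≤parts)
      where
      K : Fin N → Bool
      K s = does (W? C t s)

      covered? : ∀ s → Dec (Covered C s)
      covered? s = any? λ j → coef C j s s ≟ᵇ true

      -- `e` is uncovered and has to be adjoined separately; it is the one row by which `whole`
      -- exceeds the union of the parts.
      whole : Fin N → Bool
      whole s = K s ∧ (does (s ≟ e) ∨ does (covered? s))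

      part : Fin r → Fin N → Bool
      part j s = K s ∧ coef C j s s

      row : Fin r → Fin N → Fin n → Bool
      row j s c = part j s ∧ M s c

      in-W : ∀ s → whole s ≡ true → W C (suc t) s
      in-W s p = stable s (does-true (W? C t s) (∧-conicalˡ _ _ p))

      expand : ∀ j g → W C (suc t) g → ∀ c → M g c ≡ ⊕.sum (λ s → coef C j g s ∧ row j s c)
      expand j g wg c = trans (proj₁ (wg j) c) (⊕.sum-cong-≗ restrict)
        where
        restrict : ∀ s → coef C j g s ∧ M s c ≡ coef C j g s ∧ row j s c
        restrict s with coef C j g s in p
        ... | false = refl
        ... | true rewrite dec-true (W? C t s) (proj₂ (wg j) s p) | member C p = refl

      bound : ∀ j → count whole ℕ.≤ r ℕ.* count (part j)
      bound j with columnBasis (row j) (part j) (λ s p c → cong (_∧ M s c) p)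
      ... | A , ∣A∣≤ , basis = ℕ.≤-trans (sparse whole A nonempty separated) (ℕ.*-monoʳ-≤ r ∣A∣≤)
        where
        -- Were `A` empty, every combination of rows of the part would vanish, among them the
        -- nonzero row `e`.
        nonempty : 0 < ∣ A ∣
        nonempty with any? (λ c → lookup A c ≟ᵇ inside)
        ... | yes (c , c∈A) = ∈⇒0<∣∣ A c c∈A
        ... | no A≡∅ with c , ec ← nonzero e = contradiction (trans (sym ec) (trans (expand j e (stable e we) c)
                (basis (coef C j e) (λ c′ c′∈A → contradiction (c′ , c′∈A) A≡∅) c))) λ ()

        separated : ∀ s s′ → whole s ≡ true → whole s′ ≡ true →
                    (∀ c → lookup A c ≡ inside → M s c ≡ M s′ c) → s ≡ s′
        -- The difference of two rows that agree on `A` is a combination of rows of the part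
        -- vanishing on `A`, hence vanishing everywhere.
        separated s s′ p p′ agree = distinct s s′ λ c → xor≡false (trans (sym (difference c))
            (basis (λ i → coef C j s i xor coef C j s′ i) (λ c′ c′∈A → trans (difference c′) (≡⇒xor (agree c′ c′∈A))) c))
          where
          difference : ∀ c → ⊕.sum (λ i → (coef C j s i xor coef C j s′ i) ∧ row j i c) ≡ M s c xor M s′ c
          difference c = trans (⊕.sum-cong-≗ λ i → ∧-distribʳ-xor (row j i c) (coef C j s i) (coef C j s′ i))
            (trans (⊕.∑-distrib-+ (λ i → coef C j s i ∧ row j i c) (λ i → coef C j s′ i ∧ row j i c))
                   (sym (cong₂ _xor_ (expand j s (in-W s p) c) (expand j s′ (in-W s′ p′) c))))

      parts : ℕ
      parts = ∑.sum (λ j → count (part j))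

      whole≤parts : count whole ℕ.≤ parts
      whole≤parts = ℕ.*-cancelˡ-≤ r (∑-lower {k = r} (λ j → count (part j)) bound)

      -- Counting by rows: disjointness puts each row into at most one part, and `e` is in none of
      -- them.
      parts<whole : parts < count whole
      parts<whole = begin
        suc (∑.sum (λ j → ∑.sum (λ s → ⟦ part j s ⟧)))
          ≡⟨ cong suc (∑.∑-comm (λ j s → ⟦ part j s ⟧)) ⟩
        suc (∑.sum (λ s → ∑.sum (λ j → ⟦ part j s ⟧)))
          ≤⟨ ∑-mono-< (λ s → pointwise s) e at-e ⟩
        count whole ∎
        where
        open ℕ.≤-Reasoning
        at-e : count (λ j → part j e) < ⟦ whole e ⟧
        at-e rewrite count-false (λ j → part j e) (λ j → trans (cong (K e ∧_) (e∉ j)) (∧-zeroʳ (K e)))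
                   | dec-true (W? C t e) we | does-≟-refl e = ℕ.≤-refl
        pointwise : ∀ s → count (λ j → part j s) ℕ.≤ ⟦ whole s ⟧
        pointwise s with K s
        ... | false = ℕ.≤-reflexive (count-false {r} _ λ _ → refl)
        ... | true with does (s ≟ e) | covered? s
        ...   | true  | _ = count-unique (λ j → coef C j s s) (λ i k → disjoint C s)
        ...   | false | yes _ = count-unique (λ j → coef C j s s) (λ i k → disjoint C s)
        ...   | false | no ¬cov = ℕ.≤-reflexive (count-false (λ j → coef C j s s) (λ j → ¬-not λ p → ¬cov (j , p)))

    cover : ∀ C e → ∃[ C′ ] C′ Extends C by e
    cover C e with any? (λ j → coef C j e e ≟ᵇ true)
    ... | yes cov = C , (λ _ cov′ → cov′) , cov
    ... | no ¬cov with t , stable ← stabilises (W C) (W? C) (W-antitone C) =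
      extend t C e e∉ (not-stable C e e∉ t stable)
      where
      e∉ : Uncovered C e
      e∉ j = ¬-not λ p → ¬cov (j , p)

    cover-all : ∀ es → Σ[ C ∈ Packing ] All (Covered C) es
    cover-all []       = empty , []
    cover-all (e ∷ es) with C , cov ← cover-all es with C′ , keeps , e∈ ← cover C e =
      C′ , e∈ ∷ All.map (λ {s} → keeps s) cov

    functionals : Σ[ X ∈ (Fin r → Fin n → Bool) ] ∀ s → ∃[ j ] ⟨ X j , M s ⟩ ≡ true
    functionals with C , cov ← cover-all (allFin N) =
      X C , λ s → let j , s∈ = All.lookup cov (∈-allFin s) in j , odd C j s s∈
      where
      X : Packing → Fin r → Fin n → Bool
      -- Each member has a single nonzero coordinate, its own, so the sum of all dual functionals is
      -- 1 on it.
      X C j u = ⊕.sum (λ s → dual C j s u)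
      odd : ∀ C j s → Member C j s → ⟨ X C j , M s ⟩ ≡ true
      odd C j s s∈ = trans (⟨⟩-sumˡ (dual C j) (M s))
        (trans (⊕.sum-cong-≗ λ s′ → trans (δ-member C j s∈ s′) (sym (∧-identityʳ _))) (⊕-select (λ _ → true) s))

-- Parity of cardinalities

-- Both parities go through the induction together, because each further element interchanges them.
parity : ∀ {n} (p : Subset n) → (⊕.sum (lookup p) ≡ true → ∣ p ∣ % 2 ≡ 1) × (⊕.sum (lookup p) ≡ false → ∣ p ∣ % 2 ≡ 0)
parity []          = (λ ()) , λ _ → refl
parity (false ∷ p) = parity p
parity (true  ∷ p) with ⊕.sum (lookup p) | parity p
... | true  | odd , _  = (λ ()) , λ _ → trans (ℕ.%-distribˡ-+ 1 ∣ p ∣ 2) (cong (λ k → suc k % 2) (odd refl))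
... | false | _ , even = (λ _ → trans (ℕ.%-distribˡ-+ 1 ∣ p ∣ 2) (cong (λ k → suc k % 2) (even refl))) , λ ()

-- Subsets, repetition-free lists and traces

∈-allSubsets : ∀ {n} (A : Subset n) → A ∈ allSubsets n
∈-allSubsets []          = here refl
∈-allSubsets (false ∷ A) = ∈-cartesianProductWith⁺ _∷_ {xs = outside ∷ inside ∷ []} (here refl) (∈-allSubsets A)
∈-allSubsets (true  ∷ A) = ∈-cartesianProductWith⁺ _∷_ {xs = outside ∷ inside ∷ []} (there (here refl)) (∈-allSubsets A)

lookup-injective : ∀ {A : Set} {xs : List A} → Unique xs → Injective _≡_ _≡_ (List.lookup xs)
lookup-injective (_  ∷ _)  {zero}  {zero}  _  = refl
lookup-injective (x∉ ∷ _)  {zero}  {suc j} eq = contradiction eq (All.lookup x∉ (∈-lookup j))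
lookup-injective (x∉ ∷ _)  {suc i} {zero}  eq = contradiction (sym eq) (All.lookup x∉ (∈-lookup i))
lookup-injective (_  ∷ xs) {suc i} {suc j} eq = cong suc (lookup-injective xs eq)

vec-ext : ∀ {n} {p q : Subset n} → (∀ c → lookup p c ≡ lookup q c) → p ≡ q
vec-ext {p = p} {q} h = trans (sym (tabulate∘lookup p)) (trans (tabulate-cong h) (tabulate∘lookup q))

lookup-∩ : ∀ (p q : Subset n) c → lookup (p ∩ q) c ≡ lookup p c ∧ lookup q c
lookup-∩ p q c = lookup-zipWith _∧_ c p q

traces≤η : ∀ G A → length (traces G A) ℕ.≤ η G ∣ A ∣
traces≤η G A = All.lookup (xs≤max 0 _)
  (∈-map⁺ (λ A → length (traces G A)) (∈-filter⁺ (λ B → ∣ B ∣ ℕ.≟ ∣ A ∣) (∈-allSubsets A) refl))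

∈-traces : ∀ G A v → N G v ∩ A ∈ traces G A
∈-traces G A v = ∈-deduplicate⁺ (≡-dec _≟ᵇ_) (∈-map⁺ (λ v → N G v ∩ A) (∈-allFin v))

-- Colours as bit vectors

bits : Fin (2 ^ r) → Fin r → Bool
bits i j = Inverse.to 2↔Bool (finToFun i j)

encode : (Fin r → Bool) → Fin (2 ^ r)
encode b = funToFin (Inverse.from 2↔Bool ∘ b)

bits-encode : ∀ (b : Fin r → Bool) j → bits (encode b) j ≡ b j
bits-encode b j = trans (cong (Inverse.to 2↔Bool) (finToFun-funToFin (Inverse.from 2↔Bool ∘ b) j))
                        (Inverse.strictlyInverseˡ 2↔Bool (b j))

-- The neighborhood matrix of a graph and its odd coloring

module _ (G : Graph) where

  open Graph G using (order)

  -- If every colour class met N v evenly, then so would every union of colour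
  -- classes, in particular the support of X j.
  functionals⇒odd : ∀ (X : Fin r → Fin order → Bool) v j → ⟨ X j , lookup (N G v) ⟩ ≡ true →
    ∃[ i ] Odd ∣ N G v ∩ colorClass G (λ u → encode (λ j → X j u)) i ∣
  functionals⇒odd {r} X v j odd with ⊕-true _ (trans (sym by-colour) odd)
    where
    c : Coloring G (2 ^ r)
    c u = encode (λ j → X j u)
    by-colour : ⟨ X j , lookup (N G v) ⟩ ≡ ⊕.sum (λ i → ⊕.sum (lookup (N G v ∩ colorClass G c i)) ∧ bits i j)
    by-colour = begin
      ⟨ X j , lookup (N G v) ⟩
        ≡⟨ ⟨⟩-sum (X j) (lookup (N G v)) ⟩
      ⊕.sum (λ u → X j u ∧ lookup (N G v) u)
        ≡⟨ ⊕.sum-cong-≗ split ⟩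
      ⊕.sum (λ u → ⊕.sum (λ i → lookup (N G v ∩ colorClass G c i) u ∧ bits i j))
        ≡⟨ ⊕.∑-comm (λ u i → lookup (N G v ∩ colorClass G c i) u ∧ bits i j) ⟩
      ⊕.sum (λ i → ⊕.sum (λ u → lookup (N G v ∩ colorClass G c i) u ∧ bits i j))
        ≡⟨ ⊕.sum-cong-≗ (λ i → sym (⊕.*-distribʳ-sum (bits i j) (lookup (N G v ∩ colorClass G c i)))) ⟩
      ⊕.sum (λ i → ⊕.sum (lookup (N G v ∩ colorClass G c i)) ∧ bits i j) ∎
      where
      open ≡-Reasoning
      indicator : ∀ u i → lookup (N G v ∩ colorClass G c i) u ∧ bits i j ≡ does (i ≟ c u) ∧ (lookup (N G v) u ∧ bits i j)
      indicator u i = begin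
        lookup (N G v ∩ colorClass G c i) u ∧ bits i j
          ≡⟨ cong (_∧ bits i j) (trans (lookup-∩ (N G v) _ u) (cong (lookup (N G v) u ∧_) (lookup∘tabulate _ u))) ⟩
        (lookup (N G v) u ∧ does (c u ≟ i)) ∧ bits i j
          ≡⟨ cong (_∧ bits i j) (trans (∧-comm (lookup (N G v) u) _) (cong (_∧ lookup (N G v) u) (does-⇔ (mk⇔ sym sym) (c u ≟ i) (i ≟ c u)))) ⟩
        (does (i ≟ c u) ∧ lookup (N G v) u) ∧ bits i j
          ≡⟨ ∧-assoc (does (i ≟ c u)) (lookup (N G v) u) (bits i j) ⟩
        does (i ≟ c u) ∧ (lookup (N G v) u ∧ bits i j) ∎
      -- Each `u` contributes only to the class of its own colour, whose j-th bit is `X j u`.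
      split : ∀ u → X j u ∧ lookup (N G v) u ≡ ⊕.sum (λ i → lookup (N G v ∩ colorClass G c i) u ∧ bits i j)
      split u = sym (begin
        ⊕.sum (λ i → lookup (N G v ∩ colorClass G c i) u ∧ bits i j)
          ≡⟨ ⊕.sum-cong-≗ (indicator u) ⟩
        ⊕.sum (λ i → does (i ≟ c u) ∧ (lookup (N G v) u ∧ bits i j))
          ≡⟨ ⊕-select (λ i → lookup (N G v) u ∧ bits i j) (c u) ⟩
        lookup (N G v) u ∧ bits (c u) j
          ≡⟨ ∧-comm (lookup (N G v) u) (bits (c u) j) ⟩
        bits (c u) j ∧ lookup (N G v) u
          ≡⟨ cong (_∧ lookup (N G v) u) (bits-encode (λ j → X j u) j) ⟩
        X j u ∧ lookup (N G v) u ∎)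
  ... | i , p = i , proj₁ (parity (N G v ∩ colorClass G (λ u → encode (λ j → X j u)) i)) (∧-conicalˡ _ _ p)

  -- Vertices with equal neighborhoods share one row, and the zero row, on which no functional can
  -- be 1, is left out.
  rows : List (Subset order)
  rows = deduplicate (≡-dec _≟ᵇ_) (filter nonempty? (map (N G) (allFin order)))

  neighborhood : ∀ i → ∃[ v ] List.lookup rows i ≡ N G v × Nonempty (List.lookup rows i)
  neighborhood i
    with row∈ , ne ← ∈-filter⁻ nonempty? {xs = map (N G) (allFin order)} (∈-deduplicate⁻ (≡-dec _≟ᵇ_) (filter nonempty? (map (N G) (allFin order))) (∈-lookup {xs = rows} i))
    with v , _ , eq ← ∈-map⁻ (N G) row∈ = v , eq , ne

  N∈rows : ∀ v → NonIsolated G v → N G v ∈ rows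
  N∈rows v (u , v~u) = ∈-deduplicate⁺ (≡-dec _≟ᵇ_) (∈-filter⁺ nonempty? (∈-map⁺ (N G) (∈-allFin v))
    (u , lookup⇒[]= u (N G v) (trans (lookup∘tabulate _ u) (dec-true (Graph.adj? G v u) v~u))))

  matrix : Fin (length rows) → Fin order → Bool
  matrix i = lookup (List.lookup rows i)

  matrix-distinct : ∀ s s′ → (∀ c → matrix s c ≡ matrix s′ c) → s ≡ s′
  matrix-distinct s s′ same = lookup-injective (deduplicate-! (≡-dec _≟ᵇ_) (filter nonempty? (map (N G) (allFin order)))) (vec-ext same)

  matrix-nonzero : ∀ s → ∃[ c ] matrix s c ≡ true
  matrix-nonzero s with _ , _ , c , c∈ ← neighborhood s = c , []=⇒lookup c∈

  -- Rows separated by `A` have distinct traces on `A`, so their positions in the list `traces G A`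
  -- are distinct, and the length of that list is at most `η G ∣ A ∣`.
  matrix-sparse : (∀ m → 0 < m → η G m ℕ.≤ r ℕ.* m) →
    ∀ (R : Fin (length rows) → Bool) (A : Subset order) → 0 < ∣ A ∣ →
    (∀ s s′ → R s ≡ true → R s′ ≡ true → (∀ c → lookup A c ≡ inside → matrix s c ≡ matrix s′ c) → s ≡ s′) →
    count R ℕ.≤ r ℕ.* ∣ A ∣
  matrix-sparse linear R A 0<∣A∣ separated with enumerate R
  ... | f , f-injective , f∈R =
      ℕ.≤-trans (injective⇒≤ trace-injective) (ℕ.≤-trans (traces≤η G A) (linear ∣ A ∣ 0<∣A∣))
    where
    trace∈ : ∀ k → List.lookup rows (f k) ∩ A ∈ traces G A
    trace∈ k with v , eq , _ ← neighborhood (f k) = subst (λ p → p ∩ A ∈ traces G A) (sym eq) (∈-traces G A v)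

    trace-injective : Injective _≡_ _≡_ (λ k → index (trace∈ k))
    trace-injective {k} {l} eq = f-injective (separated (f k) (f l) (f∈R k) (f∈R l) agree)
      where
      agree : ∀ c → lookup A c ≡ inside → matrix (f k) c ≡ matrix (f l) c
      agree c c∈A = trans (sym (at-c k)) (trans (cong (λ p → lookup p c) (index-injective (setoid _) (trace∈ k) (trace∈ l) eq)) (at-c l))
        where
        at-c : ∀ i → lookup (List.lookup rows (f i) ∩ A) c ≡ matrix (f i) c
        at-c i = trans (lookup-∩ (List.lookup rows (f i)) A c) (trans (cong (matrix (f i) c ∧_) c∈A) (∧-identityʳ _))

  oddColoring : .⦃ NonZero r ⦄ → (∀ m → 0 < m → η G m ℕ.≤ r ℕ.* m) → ∃[ c ] IsOddColoring G {2 ^ r} c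
  oddColoring {r} linear with X , covers ← Matrix.functionals matrix r matrix-distinct matrix-nonzero (matrix-sparse {r} linear) =
    (λ u → encode (λ j → X j u)) , λ v v≁ →
      let i = index (N∈rows v v≁)
          j , odd = covers i
      in functionals⇒odd X v j (subst (λ p → ⟨ X j , lookup p ⟩ ≡ true) (sym (lookup-index (N∈rows v v≁))) odd)

theorem1p2 : (r : ℤ) → Σ[ k ∈ ℕ ] ((G : Graph) → (∀ (m : ℕ) → 0 < m → + (η G m) ≤ r * + m) → ∃[ c ] IsOddColoring G {k} c)
-- Passing from `r` to `∣ r ∣ + 1` only weakens the assumed bound and makes the number of
-- independent sets a positive natural number, as the cancellation in the rank argument requires.
theorem1p2 r = 2 ^ suc ℤ.∣ r ∣ , λ G linear → oddColoring G {suc ℤ.∣ r ∣} λ m 0<m → ℤ.drop‿+≤+ (begin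
    + (η G m)                  ≤⟨ linear m 0<m ⟩
    r * + m                    ≤⟨ ℤ.*-monoʳ-≤-nonNeg (+ m) (r≤ r) ⟩
    + suc ℤ.∣ r ∣ * + m        ≡⟨ ℤ.pos-* (suc ℤ.∣ r ∣) m ⟨
    + (suc ℤ.∣ r ∣ ℕ.* m)      ∎)
  where
  open ℤ.≤-Reasoning
  r≤ : ∀ r → r ≤ + suc ℤ.∣ r ∣
  r≤ (+ n)    = ℤ.+≤+ (ℕ.n≤1+n n)
  r≤ -[1+ n ] = ℤ.-≤+
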